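{- The classes of finite degree rational graphs and of linearly bounded graphs are incomparable (up to isomorphism): there is a rational graph of finite degree which is not isomorphic to any linearly bounded graph, and there is a linearly bounded graph which is not isomorphic to any rational graph of finite degree.
   Context: Graphs. A $\Sigma$-labeled graph is a set $G\subseteq V\times\Sigma\times V$ with $\Sigma$ finite and $V$ countable; its set of vertices (support) is the set of all sources and targets of its edges. Two graphs $G,H$ are isomorphic if there is a bijection $\rho:V_H\to V_G$ with $(x,a,y)\in H$ iff $(\rho(x),a,\rho(y))\in G$. A graph has finite degree if every vertex is the source or the target of only finitely many edges. The empty word is denoted $\varepsilon$. Rational graphs. A finite transducer over $\Gamma$ is a finite automaton with labels in $(\Gamma\cup\{\varepsilon\})\times(\Gamma\cup\{\varepsilon\})$; it accepts a rational subset of $\Gamma^*\times\Gamma^*$, i.e. a binary relation on words, with which it is identified. A rational graph labeled by $\Sigma$ with vertices in $\Gamma^*$ is given by a family $(T_a)_{a\in\Sigma}$ of finite transducers over $\Gamma$: $(u,a,v)\in G$ iff $(u,v)\in T_a$. Labeled linearly bounded Turing machines (LLBMs). An LLBM is a tuple $M=(\Gamma,\Sigma,[,],Q,q_0,F,\delta)$ where $\Gamma$ is a finite set of tape symbols, $\Sigma\subseteq\Gamma$ is the input alphabet, $[,]\notin\Gamma$ are the left and right end-markers, $Q$ is a finite set of control states disjoint from $\Gamma$, $q_0\in Q$ is the initial state, $F\subseteq Q$ is the set of final states, and $\delta$ is a finite set of labeled rules of the forms $pA\xrightarrow{\varepsilon}qB\pm$, $p[\,\xrightarrow{\varepsilon}q[+$,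 $p]\xrightarrow{\varepsilon}q]-$, $pB\xrightarrow{a}qAB$, $p]\xrightarrow{a}qA]$, $pA\xrightarrow{\varepsilon}q$, with $p,q\in Q$, $A,B\in\Gamma$, $\pm\in\{+,-\}$, $a\in\Sigma$. A configuration is a word $uqv$ with $q\in Q$, $v\neq\varepsilon$ and $uv\in[\Gamma^*]$ (left marker, then a word over $\Gamma$, then right marker). For $x\in\Sigma\cup\{\varepsilon\}$ the relation $\xrightarrow{x}$ on configurations consists of the following pairs, where $X,Y\in\Gamma\cup\{[,]\}$: $upXv\xrightarrow{x}uYqv$ if $pX\xrightarrow{x}qY+\in\delta$; $uCpXv\xrightarrow{x}uqCYv$ if $pX\xrightarrow{x}qY-\in\delta$; $upAv\xrightarrow{\varepsilon}uqv$ if $pA\xrightarrow{\varepsilon}q\in\delta$; $upXv\xrightarrow{a}uqAXv$ if $pX\xrightarrow{a}qAX\in\delta$. Normalized LLBMs. $M$ is normalized if $Q$ is the disjoint union of $Q_\Sigma$ (external states) and $Q_\varepsilon$ (internal states) such that $F\subseteq Q_\Sigma$, every rule labeled by a letter of $\Sigma$ has its left-hand state $p$ in $Q_\Sigma$, every rule labeled by $\varepsilon$ has its left-hand state $p$ in $Q_\varepsilon$, and for every $p\in Q_\varepsilon$ and $X\in\Gamma\cup\{[,]\}$ there is a rule of the form $pX\xrightarrow{\varepsilon}qY\pm$ in $\delta$. A configuration is external if its control state is in $Q_\Sigma$. Linearly bounded graphs. The transition graph of a normalized LLBM $M$ is $G_M=\{(c,a,c')\mid a\in\Sigma,\ c,c'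 \text{ external configurations, } c\xrightarrow{a\varepsilon^*}c'\}$, where $c\xrightarrow{a\varepsilon^*}c'$ means one $a$-transition followed by finitely many (possibly zero) $\varepsilon$-transitions. A linearly bounded graph is any graph isomorphic to the transition graph of some normalized LLBM. -}

module Defs where

open import Data.Fin.Base using (Fin)
open import Data.Fin.Subset using (Subset) renaming (_∈_ to _∈ₛ_; _∉_ to _∉ₛ_)
open import Data.List.Base using (List; []; _∷_; _++_; _∷ʳ_; [_]; map; _?∷_)
open import Data.List.Membership.Propositional using (_∈_)
open import Data.List.Relation.Unary.All using (All)
open import Data.Maybe.Base using (Maybe; just; nothing)
open import Data.Nat.Base using (ℕ)
open import Data.Product.Base using (∃; _×_; _,_; proj₁)
open import Data.Sum.Base using (_⊎_)
open import Function.Bundles using (_↣_; _⇔_; Bijection; module Injection)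
open import Relation.Binary.Bundles using (Setoid)
open import Relation.Binary.Construct.Closure.ReflexiveTransitive using (Star)
import Relation.Binary.Construct.On as On
open import Relation.Binary.PropositionalEquality using (_≡_; _≢_; setoid)

------------------------------------------------------------------------
-- Graphs

-- Edge labels live in a common countable stock of symbols, so that graphs over
-- different finite alphabets can be compared.
Symbol : Set
Symbol = ℕ

record Alphabet : Set where
  field
    size   : ℕ
    naming : Fin size ↣ Symbol

  symbol : Fin size → Symbol
  symbol = Injection.to naming

-- V is only an ambient set; the vertices of the graph are the elements of its
-- support. That the labels form a finite alphabet and that V is countable is
-- not recorded here: both hold for the rational graphs and transition graphs
-- defined below.
record Graph : Set₁ where
  field
    V    : Set
    Edge : V → Symbol → V → Set

open Graph public

Support : (G : Graph) → V G → Set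
Support G x = ∃ λ a → ∃ λ y → Edge G x a y ⊎ Edge G y a x

-- The support as a set: the proof of membership is ignored by the equality.
Vertices : Graph → Setoid _ _
Vertices G = On.setoid {B = ∃ (Support G)} (setoid (V G)) proj₁

infix 4 _≅_

record _≅_ (G H : Graph) : Set where
  field
    ρ : Bijection (Vertices H) (Vertices G)

  open Bijection ρ using (to)

  field
    preserves : ∀ x a y →
      Edge H (proj₁ x) a (proj₁ y) ⇔ Edge G (proj₁ (to x)) a (proj₁ (to y))

FiniteDegree : Graph → Set
FiniteDegree G = ∀ x → Support G x →
  ∃ λ (es : List (V G × Symbol × V G)) →
    ∀ {s a t} → Edge G s a t → s ≡ x ⊎ t ≡ x → (s , a , t) ∈ es

------------------------------------------------------------------------
-- Rational graphs

-- The label nothing stands for ε.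
record Transducer (k : ℕ) : Set where
  field
    states      : ℕ
    initial     : Subset states
    final       : Subset states
    transitions : List (Fin states × (Maybe (Fin k) × Maybe (Fin k)) × Fin states)

  data Run : Fin states → List (Fin k) → List (Fin k) → Fin states → Set where
    stop : ∀ {p} → Run p [] [] p
    step : ∀ {p x y q u v r} →
           (p , (x , y) , q) ∈ transitions →
           Run q u v r → Run p (x ?∷ u) (y ?∷ v) r

  Accepts : List (Fin k) → List (Fin k) → Set
  Accepts u v =
    ∃ λ p → ∃ λ q → p ∈ₛ initial × q ∈ₛ final × Run p u v q

record RationalPresentation : Set where
  field
    Σ : Alphabet
    Γ : Alphabet

  module Σ = Alphabet Σ
  module Γ = Alphabet Γ

  field
    T : Fin Σ.size → Transducer Γ.size

rationalGraph : RationalPresentation → Graph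
rationalGraph R = record
  { V    = List (Fin Γ.size)
  ; Edge = λ u x v → ∃ λ a → x ≡ Σ.symbol a × Transducer.Accepts (T a) u v
  }
  where open RationalPresentation R

------------------------------------------------------------------------
-- Labeled linearly bounded Turing machines

data Direction : Set where
  ⊕ ⊖ : Direction

-- ⊢ and ⊣ are the end-markers.
data TapeSymbol (g : ℕ) : Set where
  ⊢ ⊣    : TapeSymbol g
  letter : Fin g → TapeSymbol g

module _ (g s : ℕ) where

  -- move p X q Y d : pX →ε qYd,   insert p X a q A : pX →a qAX,
  -- erase p A q    : pA →ε q
  data Rule : Set where
    move   : Fin s → TapeSymbol g → Fin s → TapeSymbol g → Direction → Rule
    insert : Fin s → TapeSymbol g → Fin g → Fin s → Fin g → Rule
    erase  : Fin s → Fin g → Fin s → Rule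

module _ {g s : ℕ} where

  data Admissible (Σ : Subset g) : Rule g s → Set where
    pA→qB± : ∀ {p A q B d} → Admissible Σ (move p (letter A) q (letter B) d)
    p⊢→q⊢+ : ∀ {p q} → Admissible Σ (move p ⊢ q ⊢ ⊕)
    p⊣→q⊣- : ∀ {p q} → Admissible Σ (move p ⊣ q ⊣ ⊖)
    pB→qAB : ∀ {p B a q A} → a ∈ₛ Σ → Admissible Σ (insert p (letter B) a q A)
    p⊣→qA⊣ : ∀ {p a q A} → a ∈ₛ Σ → Admissible Σ (insert p ⊣ a q A)
    pA→q   : ∀ {p A q} → Admissible Σ (erase p A q)

  source : Rule g s → Fin s
  source (move p _ _ _ _)   = p
  source (insert p _ _ _ _) = p
  source (erase p _ _)      = p

  label : Rule g s → Maybe (Fin g)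
  label (move _ _ _ _ _)   = nothing
  label (insert _ _ a _ _) = just a
  label (erase _ _ _)      = nothing

-- The word u q v, split at its only control state.
record Word (g s : ℕ) : Set where
  constructor _⟨_⟩_
  field
    left  : List (TapeSymbol g)
    state : Fin s
    right : List (TapeSymbol g)

record LLBM : Set where
  field
    Γ : Alphabet

  module Γ = Alphabet Γ

  field
    Σ          : Subset Γ.size
    states     : ℕ
    q₀         : Fin states
    F          : Subset states
    δ          : List (Rule Γ.size states)
    admissible : All (Admissible Σ) δ

  TapeWord : Set
  TapeWord = Word Γ.size states

  IsConfiguration : TapeWord → Set
  IsConfiguration (u ⟨ q ⟩ v) =
    v ≢ [] × ∃ λ w → u ++ v ≡ ⊢ ∷ map letter w ++ [ ⊣ ]

  data Rewrites : Maybe (Fin Γ.size) → TapeWord → TapeWord → Set where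
    moveʳ  : ∀ {u v p X q Y} → move p X q Y ⊕ ∈ δ →
             Rewrites nothing (u ⟨ p ⟩ (X ∷ v)) ((u ∷ʳ Y) ⟨ q ⟩ v)
    moveˡ  : ∀ {u v C p X q Y} → move p X q Y ⊖ ∈ δ →
             Rewrites nothing ((u ∷ʳ C) ⟨ p ⟩ (X ∷ v)) (u ⟨ q ⟩ (C ∷ Y ∷ v))
    erase  : ∀ {u v p A q} → erase p A q ∈ δ →
             Rewrites nothing (u ⟨ p ⟩ (letter A ∷ v)) (u ⟨ q ⟩ v)
    insert : ∀ {u v p X a q A} → insert p X a q A ∈ δ →
             Rewrites (just a) (u ⟨ p ⟩ (X ∷ v)) (u ⟨ q ⟩ (letter A ∷ X ∷ v))

  Step : Maybe (Fin Γ.size) → TapeWord → TapeWord → Set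
  Step x c c′ = IsConfiguration c × IsConfiguration c′ × Rewrites x c c′

-- The internal states are those outside the subset external.
record Normalized (M : LLBM) : Set where
  open LLBM M
  field
    external   : Subset states
    F⊆external : ∀ {p} → p ∈ₛ F → p ∈ₛ external
    Σ-rules    : ∀ {r a} → r ∈ δ → label r ≡ just a → source r ∈ₛ external
    ε-rules    : ∀ {r} → r ∈ δ → label r ≡ nothing → source r ∉ₛ external
    total      : ∀ {p} → p ∉ₛ external → ∀ X →
                 ∃ λ q → ∃ λ Y → ∃ λ d → move p X q Y d ∈ δ

  External : TapeWord → Set
  External c = IsConfiguration c × Word.state c ∈ₛ external

transitionGraph : (M : LLBM) → Normalized M → Graph
transitionGraph M N = record
  { V    = TapeWord
  ; Edge = λ c x c′ →
      ∃ λ a → a ∈ₛ Σ × x ≡ Γ.symbol a ×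
      External c × External c′ ×
      ∃ λ c₁ → Step (just a) c c₁ × Star (Step nothing) c₁ c′
  }
  where
  open LLBM M
  open Normalized N

LinearlyBounded : Graph → Set
LinearlyBounded G = ∃ λ M → ∃ λ (N : Normalized M) → G ≅ transitionGraph M N

-- A rational relation can double the length of a word, so the rational graph
-- with an edge u → v whenever |v| = 2|u| has finite degree, but its vertices of
-- length 2ⁿ, of which there are 2^(2ⁿ), are reached after n edges. In a transition
-- graph an edge lengthens a configuration by at most one cell, so n edges reach
-- only exponentially many configurations. Conversely, a machine erasing its
-- tape by ε-transitions has a vertex of infinite in-degree.

module Submission where

open import Defs
open import Data.Fin.Base using (Fin; zero; suc; toℕ; combine; quotient; remainder)
open import Data.Fin.Properties using (combine-remQuot; injective⇒≤; toℕ-injective)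
open import Data.Fin.Subset using (Subset; inside; outside; ⊥) renaming (_∈_ to _∈ₛ_; _∉_ to _∉ₛ_)
open import Data.Fin.Subset.Properties using (∉⊥)
open import Data.List.Base
  using (List; []; _∷_; _++_; _∷ʳ_; [_]; map; length; replicate; allFin;
         cartesianProductWith; cartesianProduct; lookup)
open import Data.List.Membership.Propositional using (_∈_)
open import Data.List.Membership.Propositional.Properties
  using (∈-allFin; ∈-map⁺; ∈-cartesianProductWith⁺; ∈-cartesianProduct⁺; finite)
open import Data.List.Properties
  using (length-++; length-map; length-tabulate; length-replicate; length-++-sucʳ;
         length-++-≤ˡ; length-++-≤ʳ; ∷ʳ-++; map-++; ∷-injectiveˡ; ∷-injectiveʳ)
open import Data.List.Relation.Unary.All using ([]; _∷_)
open import Data.List.Relation.Unary.Any using (here; there; index)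
open import Data.List.Relation.Unary.Any.Properties using (lookup-index)
open import Data.Maybe.Base using (just; nothing)
open import Data.Nat.Base
open import Data.Nat.Properties
open import Data.Nat.Tactic.RingSolver using (solve-∀)
open import Data.Product.Base using (∃; _×_; _,_; proj₁; proj₂; uncurry)
open import Data.Sum.Base using (_⊎_; inj₁; inj₂)
open import Data.Vec.Base using ([]; _∷_; here; there)
open import Function.Base using (id; _∘_)
open import Function.Bundles using (Bijection; Equivalence; _↣_; mk↣)
open import Function.Construct.Identity using (bijection; ⇔-id)
open import Function.Definitions using (Injective)
open import Level using (Level)
open import Relation.Binary.Construct.Closure.ReflexiveTransitive using (Star; ε; _◅_)
open import Relation.Binary.PropositionalEquality
  using (_≡_; refl; sym; trans; cong; cong₂; subst; subst₂; module ≡-Reasoning)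
open import Relation.Nullary.Negation.Core using (¬_; contradiction)

private
  variable
    a b c : Level
    A : Set a
    B : Set b
    C : Set c

-- Embeddings of graphs

infix 4 _↪_

-- This is the part of an isomorphism on which both halves rely. Vertices are compared by first
-- projections, as in `Vertices`, so that proofs of membership in the support are ignored.
record _↪_ (G H : Graph) : Set where
  field
    to        : ∃ (Support G) → ∃ (Support H)
    injective : ∀ {x y} → proj₁ (to x) ≡ proj₁ (to y) → proj₁ x ≡ proj₁ y
    preserves : ∀ {x a y} → Edge G (proj₁ x) a (proj₁ y) →
                Edge H (proj₁ (to x)) a (proj₁ (to y))

-- The bijection `ρ` of `G ≅ H` runs from `H` to `G`, so the embedding is its section `to⁻`.
≅⇒↪ : ∀ {G H} → G ≅ H → G ↪ H
≅⇒↪ {G} {H} G≅H = record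
  { to        = to⁻
  ; injective = λ {x} {y} eq → trans (sym (to∘to⁻ x))
      (trans (ρ.cong {to⁻ x} {to⁻ y} eq) (to∘to⁻ y))
  ; preserves = λ {x} {a} {y} e → Equivalence.from (preserves (to⁻ x) a (to⁻ y))
      (subst₂ (λ s t → Edge G s a t) (sym (to∘to⁻ x)) (sym (to∘to⁻ y)) e)
  }
  where
  open _≅_ G≅H
  module ρ = Bijection ρ
  open ρ using (to⁻)
  to∘to⁻ : ∀ x → proj₁ (ρ.to (to⁻ x)) ≡ proj₁ x
  to∘to⁻ x = proj₂ (ρ.strictlySurjective x)

↪-trans : ∀ {G H K} → G ↪ H → H ↪ K → G ↪ K
↪-trans f g = record
  { to        = g.to ∘ f.to
  ; injective = f.injective ∘ g.injective
  ; preserves = g.preserves ∘ f.preserves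
  }
  where
  module f = _↪_ f
  module g = _↪_ g

≅-refl : ∀ {G} → G ≅ G
≅-refl {G} = record
  { ρ         = bijection (Vertices G)
  ; preserves = λ _ _ _ → ⇔-id _
  }

-- Counting words and configurations

length-cartesianProductWith : ∀ (f : A → B → C) xs ys →
  length (cartesianProductWith f xs ys) ≡ length xs * length ys
length-cartesianProductWith f []       ys = refl
length-cartesianProductWith f (x ∷ xs) ys = trans (length-++ (map (f x) ys))
  (cong₂ _+_ (length-map (f x) ys) (length-cartesianProductWith f xs ys))

listsUpTo : List A → ℕ → List (List A)
listsUpTo xs zero    = [ [] ]
listsUpTo xs (suc m) = [] ∷ cartesianProductWith _∷_ xs (listsUpTo xs m)

∈-listsUpTo : ∀ {xs : List A} → (∀ x → x ∈ xs) → ∀ {m} w → length w ≤ m → w ∈ listsUpTo xs m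
∈-listsUpTo all {zero}  []      _       = here refl
∈-listsUpTo all {suc m} []      _       = here refl
∈-listsUpTo all {suc m} (x ∷ w) (s≤s p) =
  there (∈-cartesianProductWith⁺ _∷_ (all x) (∈-listsUpTo all w p))

-- Padding with a blank embeds these lists into the words of length `m` over one more letter. In the
-- induction, one of the `suc (length xs)` copies of the power pays for the empty list.
length-listsUpTo : ∀ (xs : List A) m → length (listsUpTo xs m) ≤ suc (length xs) ^ m
length-listsUpTo xs zero    = ≤-refl
length-listsUpTo xs (suc m) = +-mono-≤ (m^n>0 (suc (length xs)) m) (begin
  length (cartesianProductWith _∷_ xs (listsUpTo xs m)) ≡⟨ length-cartesianProductWith _∷_ xs (listsUpTo xs m) ⟩
  length xs * length (listsUpTo xs m)                   ≤⟨ *-monoʳ-≤ (length xs) (length-listsUpTo xs m) ⟩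
  length xs * suc (length xs) ^ m                       ∎)
  where open ≤-Reasoning

tapeSymbols : ∀ g → List (TapeSymbol g)
tapeSymbols g = ⊢ ∷ ⊣ ∷ map letter (allFin g)

∈-tapeSymbols : ∀ {g} (X : TapeSymbol g) → X ∈ tapeSymbols g
∈-tapeSymbols ⊢          = here refl
∈-tapeSymbols ⊣          = there (here refl)
∈-tapeSymbols (letter A) = there (there (∈-map⁺ letter (∈-allFin A)))

length-tapeSymbols : ∀ g → length (tapeSymbols g) ≡ 2 + g
length-tapeSymbols g =
  cong (2 +_) (trans (length-map letter (allFin g)) (length-tabulate {n = g} id))

∣_∣ : ∀ {g s} → Word g s → ℕ
∣ u ⟨ q ⟩ v ∣ = length (u ++ v)

-- A deliberate overcount: both halves of the tape range independently up to length `m`. The count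
-- stays exponential in `m`, far below a double exponential.
wordsUpTo : ∀ g s → ℕ → List (Word g s)
wordsUpTo g s m = cartesianProductWith (λ q (u , v) → u ⟨ q ⟩ v) (allFin s)
  (cartesianProduct (listsUpTo (tapeSymbols g) m) (listsUpTo (tapeSymbols g) m))

∈-wordsUpTo : ∀ {g s m} (c : Word g s) → ∣ c ∣ ≤ m → c ∈ wordsUpTo g s m
∈-wordsUpTo (u ⟨ q ⟩ v) p = ∈-cartesianProductWith⁺ (λ q (u , v) → u ⟨ q ⟩ v) (∈-allFin q)
  (∈-cartesianProduct⁺
    (∈-listsUpTo ∈-tapeSymbols u (≤-trans (length-++-≤ˡ u) p))
    (∈-listsUpTo ∈-tapeSymbols v (≤-trans (length-++-≤ʳ v {u}) p)))

n<2^n : ∀ n → n < 2 ^ n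
n<2^n zero    = ≤-refl
n<2^n (suc n) = begin-strict
  suc n             ≡⟨ +-comm 1 n ⟩
  n + 1             <⟨ +-mono-<-≤ (n<2^n n) (m^n>0 2 n) ⟩
  2 ^ n + 2 ^ n     ≡⟨ cong (2 ^ n +_) (+-identityʳ (2 ^ n)) ⟨
  2 ^ suc n         ∎
  where open ≤-Reasoning

-- All factors are brought to base 2, so that the comparison with a double exponential becomes one
-- of exponents. The exponent here is linear in `m`.
length-wordsUpTo : ∀ g s m → length (wordsUpTo g s m) < 2 ^ (s + (3 + g) * (m + m))
length-wordsUpTo g s m = begin-strict
  length (wordsUpTo g s m)
    ≡⟨ length-cartesianProductWith _ (allFin s) _ ⟩
  length (allFin s) * length (cartesianProduct L L)
    ≡⟨ cong₂ _*_ (length-tabulate {n = s} id) (length-cartesianProductWith _,_ L L) ⟩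
  s * (length L * length L)
    ≤⟨ *-monoʳ-≤ s (*-mono-≤ length-L length-L) ⟩
  s * (2 ^ (k * m) * 2 ^ (k * m))
    ≡⟨ cong (s *_) (trans (cong (2 ^_) (*-distribˡ-+ k m m)) (^-distribˡ-+-* 2 (k * m) (k * m))) ⟨
  s * 2 ^ (k * (m + m))
    <⟨ *-monoˡ-< (2 ^ (k * (m + m))) {{m^n≢0 2 (k * (m + m))}} (n<2^n s) ⟩
  2 ^ s * 2 ^ (k * (m + m))
    ≡⟨ ^-distribˡ-+-* 2 s (k * (m + m)) ⟨
  2 ^ (s + k * (m + m)) ∎
  where
  open ≤-Reasoning
  -- Two end-markers and `g` letters, plus the one added in the bound of `length-listsUpTo`.
  k = 3 + g
  L = listsUpTo (tapeSymbols g) m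
  length-L : length L ≤ 2 ^ (k * m)
  length-L = begin
    length L                           ≤⟨ length-listsUpTo (tapeSymbols g) m ⟩
    suc (length (tapeSymbols g)) ^ m   ≡⟨ cong (λ l → suc l ^ m) (length-tapeSymbols g) ⟩
    k ^ m                              ≤⟨ ^-monoˡ-≤ m (<⇒≤ (n<2^n k)) ⟩
    (2 ^ k) ^ m                        ≡⟨ ^-*-assoc 2 k m ⟩
    2 ^ (k * m)                        ∎

-- At `n = 2j` the power dominates the square of `j + 1`. With `j = a + 2b`, the term `j * j` of
-- that square covers `b * n` and its linear terms cover `a`; `rest` is the exact surplus.
linear≤2^ : ∀ a b → ∃ λ n → a + b * n ≤ 2 ^ n
linear≤2^ a b = j + j , (begin
  a + b * (j + j)              ≤⟨ m≤m+n (a + b * (j + j)) _ ⟩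
  a + b * (j + j) + rest       ≡⟨ square a b ⟩
  suc j * suc j                ≤⟨ *-mono-≤ (n<2^n j) (n<2^n j) ⟩
  2 ^ j * 2 ^ j                ≡⟨ ^-distribˡ-+-* 2 j j ⟨
  2 ^ (j + j)                  ∎)
  where
  open ≤-Reasoning
  j = a + (b + b)
  rest = 1 + a + (b + b) + (b + b) + a * j
  square : ∀ a b → a + b * ((a + (b + b)) + (a + (b + b)))
         + (1 + a + (b + b) + (b + b) + a * (a + (b + b)))
         ≡ suc (a + (b + b)) * suc (a + (b + b))
  square = solve-∀

-- Base-`k` expansion, leading digit first: it supplies `k ^ n` distinct words of length `n` for the
-- pigeonhole argument.
digits : ∀ {k} n → Fin (k ^ n) → List (Fin k)
digits     zero    i = []
digits {k} (suc n) i = quotient (k ^ n) i ∷ digits n (remainder {k} (k ^ n) i)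

length-digits : ∀ {k} n (i : Fin (k ^ n)) → length (digits n i) ≡ n
length-digits     zero    i = refl
length-digits {k} (suc n) i = cong suc (length-digits n (remainder {k} (k ^ n) i))

digits-injective : ∀ {k} n → Injective _≡_ _≡_ (digits {k} n)
digits-injective     zero    {zero} {zero} _  = refl
digits-injective {k} (suc n) {i}    {j}    eq = begin
  i           ≡⟨ combine-remQuot {k} (k ^ n) i ⟨
  recombine i ≡⟨ cong₂ combine (∷-injectiveˡ eq) (digits-injective n (∷-injectiveʳ eq)) ⟩
  recombine j ≡⟨ combine-remQuot {k} (k ^ n) j ⟩
  j           ∎
  where
  open ≡-Reasoning
  recombine : Fin (k * k ^ n) → Fin (k * k ^ n)
  recombine i = combine (quotient {k} (k ^ n) i) (remainder {k} (k ^ n) i)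

-- The position of `f i` in `xs` determines `f i`, hence `i`.
injective⇒≤length : ∀ {n} {f : Fin n → A} {xs} → Injective _≡_ _≡_ f → (∀ i → f i ∈ xs) → n ≤ length xs
injective⇒≤length {f = f} {xs} f-injective f∈xs = injective⇒≤ {f = index ∘ f∈xs} λ {i} {j} eq →
  f-injective (trans (lookup-index (f∈xs i))
    (trans (cong (lookup xs) eq) (sym (lookup-index (f∈xs j)))))

-- Growth in transition graphs

module _ (M : LLBM) where
  open LLBM M

  weight : ∀ {x} {c c′ : TapeWord} → Rewrites x c c′ → ℕ
  weight {just _}  _ = 1
  weight {nothing} _ = 0

  -- Moves overwrite a cell in place and `erase` removes one. Only `insert` adds a cell, and it is
  -- the only rewrite labeled by a letter.
  Rewrites-growth : ∀ {x c c′} (r : Rewrites x c c′) → ∣ c′ ∣ ≤ weight r + ∣ c ∣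
  Rewrites-growth (moveʳ {u} {v} {X = X} {Y = Y} _) = ≤-reflexive (begin
    length ((u ∷ʳ Y) ++ v)     ≡⟨ cong length (∷ʳ-++ u Y v) ⟩
    length (u ++ Y ∷ v)        ≡⟨ length-++ u ⟩
    length u + suc (length v)  ≡⟨ length-++ u ⟨
    length (u ++ X ∷ v)        ∎)
    where open ≡-Reasoning
  Rewrites-growth (moveˡ {u} {v} {C} {X = X} {Y = Y} _) = ≤-reflexive (begin
    length (u ++ C ∷ Y ∷ v)       ≡⟨ length-++ u ⟩
    length u + (2 + length v)     ≡⟨ length-++ u ⟨
    length (u ++ C ∷ X ∷ v)       ≡⟨ cong length (∷ʳ-++ u C (X ∷ v)) ⟨
    length ((u ∷ʳ C) ++ X ∷ v)    ∎)
    where open ≡-Reasoning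
  Rewrites-growth (erase {u} {v} {A = A} _) =
    ≤-trans (n≤1+n _) (≤-reflexive (sym (length-++-sucʳ u (letter A) v)))
  Rewrites-growth (insert {u} {v} {X = X} {A = A} _) = ≤-reflexive (length-++-sucʳ u (letter A) (X ∷ v))

  ε*-growth : ∀ {c c′} → Star (Step nothing) c c′ → ∣ c′ ∣ ≤ ∣ c ∣
  ε*-growth ε                  = ≤-refl
  ε*-growth ((_ , _ , r) ◅ rs) = ≤-trans (ε*-growth rs) (Rewrites-growth r)

  Edge-growth : ∀ {N c x c′} → Edge (transitionGraph M N) c x c′ → ∣ c′ ∣ ≤ suc ∣ c ∣
  Edge-growth (_ , _ , _ , _ , _ , _ , (_ , _ , r) , rs) = ≤-trans (ε*-growth rs) (Rewrites-growth r)

-- The length-doubling rational graph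

finAlphabet : ℕ → Alphabet
finAlphabet n = record { size = n ; naming = mk↣ toℕ-injective }

-- State `zero` lies between input letters; state `suc zero` owes the second output letter. Output
-- letters are free, so a word is related to every word of twice its length.
doubling : Transducer 2
doubling = record
  { states      = 2
  ; initial     = inside ∷ outside ∷ []
  ; final       = inside ∷ outside ∷ []
  ; transitions =
      (zero , (just zero , just zero) , suc zero) ∷
      (zero , (just zero , just (suc zero)) , suc zero) ∷
      (zero , (just (suc zero) , just zero) , suc zero) ∷
      (zero , (just (suc zero) , just (suc zero)) , suc zero) ∷
      (suc zero , (nothing , just zero) , zero) ∷
      (suc zero , (nothing , just (suc zero)) , zero) ∷ []
  }

open Transducer doubling using (Run; Accepts; stop; step; transitions)

read : ∀ A B → (zero , (just A , just B) , suc zero) ∈ transitions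
read zero       zero       = here refl
read zero       (suc zero) = there (here refl)
read (suc zero) zero       = there (there (here refl))
read (suc zero) (suc zero) = there (there (there (here refl)))

pad : ∀ B → (suc zero , (nothing , just B) , zero) ∈ transitions
pad zero       = there (there (there (there (here refl))))
pad (suc zero) = there (there (there (there (there (here refl)))))

Accepts-complete : ∀ u v → length v ≡ length u * 2 → Accepts u v
Accepts-complete u v eq = zero , zero , here , here , run u v eq
  where
  run : ∀ u v → length v ≡ length u * 2 → Run zero u v zero
  run []      []           _  = stop
  run (A ∷ u) (B ∷ C ∷ v) eq =
    step (read A B) (step (pad C) (run u v (suc-injective (suc-injective eq))))

-- The number of a state is the number of output letters owed, which makes the equation an
-- invariant. Each of the six transitions writes one letter and raises both sides by one.
Run-length : ∀ {p u v q} → Run p u v q → toℕ q + length v ≡ toℕ p + length u * 2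
Run-length stop = refl
Run-length {q = q} (step {v = v} t run) with eq ← Run-length run | t
... | here refl                                         = trans (+-suc (toℕ q) (length v)) (cong suc eq)
... | there (here refl)                                 = trans (+-suc (toℕ q) (length v)) (cong suc eq)
... | there (there (here refl))                         = trans (+-suc (toℕ q) (length v)) (cong suc eq)
... | there (there (there (here refl)))                 = trans (+-suc (toℕ q) (length v)) (cong suc eq)
... | there (there (there (there (here refl))))         = trans (+-suc (toℕ q) (length v)) (cong suc eq)
... | there (there (there (there (there (here refl))))) = trans (+-suc (toℕ q) (length v)) (cong suc eq)

Accepts-sound : ∀ {u v} → Accepts u v → length v ≡ length u * 2
Accepts-sound (zero , zero , _ , _ , run)       = Run-length run
Accepts-sound (zero , suc zero , _ , there () , _)
Accepts-sound (suc zero , _ , there () , _)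

doublingPresentation : RationalPresentation
doublingPresentation = record { Σ = finAlphabet 1 ; Γ = finAlphabet 2 ; T = λ _ → doubling }

doublingGraph : Graph
doublingGraph = rationalGraph doublingPresentation

doublingEdge : ∀ {u v} → length v ≡ length u * 2 → Edge doublingGraph u 0 v
doublingEdge eq = zero , refl , Accepts-complete _ _ eq

-- The other end of an edge at `w` has twice or half the length of `w`, so both ends occur among the
-- words of length at most `n * 2`.
doubling-finiteDegree : FiniteDegree doublingGraph
doubling-finiteDegree w _ = cartesianProductWith (λ u v → u , 0 , v) L L , incident
  where
  n = length w
  L = listsUpTo (allFin 2) (n * 2)

  short : ∀ {u} → length u ≤ n * 2 → u ∈ L
  short = ∈-listsUpTo ∈-allFin _

  incident : ∀ {u a v} → Edge doublingGraph u a v → u ≡ w ⊎ v ≡ w →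
             (u , a , v) ∈ cartesianProductWith (λ u v → u , 0 , v) L L
  incident (zero , refl , acc) (inj₁ refl) = ∈-cartesianProductWith⁺ (λ u v → u , 0 , v)
    (short (m≤m*n n 2)) (short (≤-reflexive (Accepts-sound acc)))
  incident {u} (zero , refl , acc) (inj₂ refl) = ∈-cartesianProductWith⁺ (λ u v → u , 0 , v)
    (short (≤-trans (m≤m*n (length u) 2) (≤-trans (≤-reflexive (sym (Accepts-sound acc))) (m≤m*n n 2))))
    (short (m≤m*n n 2))

doubling-notEmbeddable : ∀ M N → ¬ (doublingGraph ↪ transitionGraph M N)
doubling-notEmbeddable M N e = <⇒≱ tooFew enough
  where
  open LLBM M using (module Γ; states; TapeWord)
  module e = _↪_ e

  vertex : List (Fin 2) → ∃ (Support doublingGraph)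
  vertex w = w , 0 , replicate (length w * 2) zero , inj₁ (doublingEdge (length-replicate _))

  image : List (Fin 2) → TapeWord
  image w = proj₁ (e.to (vertex w))

  image-growth : ∀ {u v} → length v ≡ length u * 2 → ∣ image v ∣ ≤ suc ∣ image u ∣
  image-growth {u} {v} eq =
    Edge-growth M {N} (e.preserves {vertex u} {0} {vertex v} (doublingEdge eq))

  -- One path suffices: every word of length `2 ^ suc n` is a successor of `spine n`, so a bound
  -- along the path bounds the images of that whole level. The path starts at length 1, since the
  -- empty word has only itself as successor.
  spine : ℕ → List (Fin 2)
  spine n = replicate (2 ^ n) zero

  spine-length : ∀ n → 2 ^ suc n ≡ length (spine n) * 2
  spine-length n = trans (*-comm 2 (2 ^ n)) (cong (_* 2) (sym (length-replicate (2 ^ n))))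

  ℓ = ∣ image (spine 0) ∣

  spine-growth : ∀ n → ∣ image (spine n) ∣ ≤ n + ℓ
  spine-growth zero    = ≤-refl
  spine-growth (suc n) = ≤-trans
    (image-growth (trans (length-replicate (2 ^ suc n)) (spine-length n)))
    (s≤s (spine-growth n))

  image-bound : ∀ n {w} → length w ≡ 2 ^ suc n → ∣ image w ∣ ≤ suc n + ℓ
  image-bound n eq = ≤-trans (image-growth (trans eq (spine-length n))) (s≤s (spine-growth n))

  k = 3 + Γ.size

  -- This is `states + k * (m + m)` with `m = suc n + ℓ`, regrouped as a constant plus a multiple of
  -- `n`.
  large : ∃ λ n → (states + k * (2 + (ℓ + ℓ))) + (k * 2) * n ≤ 2 ^ n
  large = linear≤2^ (states + k * (2 + (ℓ + ℓ))) (k * 2)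

  n = proj₁ large
  m = suc n + ℓ

  exponents : states + k * (m + m) ≤ 2 ^ suc n
  exponents = begin
    states + k * (m + m)                                ≡⟨ regroup states k ℓ n ⟩
    (states + k * (2 + (ℓ + ℓ))) + (k * 2) * n          ≤⟨ proj₂ large ⟩
    2 ^ n                                               ≤⟨ ^-monoʳ-≤ 2 (n≤1+n n) ⟩
    2 ^ suc n                                           ∎
    where
    open ≤-Reasoning
    regroup : ∀ s k ℓ n → s + k * ((suc n + ℓ) + (suc n + ℓ)) ≡ (s + k * (2 + (ℓ + ℓ))) + (k * 2) * n
    regroup = solve-∀

  tooFew : length (wordsUpTo Γ.size states m) < 2 ^ (2 ^ suc n)
  tooFew = <-≤-trans (length-wordsUpTo Γ.size states m) (^-monoʳ-≤ 2 exponents)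

  enough : 2 ^ (2 ^ suc n) ≤ length (wordsUpTo Γ.size states m)
  enough = injective⇒≤length {f = image ∘ digits {2} (2 ^ suc n)}
    (digits-injective (2 ^ suc n) ∘ e.injective)
    (λ i → ∈-wordsUpTo _ (image-bound n (length-digits {2} (2 ^ suc n) i)))

-- A linearly bounded graph of infinite in-degree

-- From the external state 0, inserting a letter before ⊣ starts the internal
-- state 1, which may erase the tape from right to left.
eraser : LLBM
eraser = record
  { Γ          = finAlphabet 1
  ; Σ          = inside ∷ []
  ; states     = 2
  ; q₀         = zero
  ; F          = ⊥
  ; δ          =
      insert zero ⊣ zero (suc zero) zero ∷
      erase (suc zero) zero (suc zero) ∷
      move (suc zero) ⊣ (suc zero) ⊣ ⊖ ∷
      move (suc zero) ⊢ zero ⊢ ⊕ ∷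
      move (suc zero) (letter zero) (suc zero) (letter zero) ⊖ ∷ []
  ; admissible = p⊣→qA⊣ here ∷ pA→q ∷ p⊣→q⊣- ∷ p⊢→q⊢+ ∷ pA→qB± ∷ []
  }

eraser-normalized : Normalized eraser
eraser-normalized = record
  { external   = external
  ; F⊆external = λ p∈⊥ → contradiction p∈⊥ ∉⊥
  ; Σ-rules    = Σ-rules
  ; ε-rules    = ε-rules
  ; total      = total
  }
  where
  open LLBM eraser using (δ)
  external : Subset 2
  external = inside ∷ outside ∷ []

  Σ-rules : ∀ {r a} → r ∈ δ → label r ≡ just a → source r ∈ₛ external
  Σ-rules (here refl) _ = here
  Σ-rules (there (here refl)) ()
  Σ-rules (there (there (here refl))) ()
  Σ-rules (there (there (there (here refl)))) ()
  Σ-rules (there (there (there (there (here refl))))) ()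

  1∉external : suc zero ∉ₛ external
  1∉external (there ())

  ε-rules : ∀ {r} → r ∈ δ → label r ≡ nothing → source r ∉ₛ external
  ε-rules (here refl) ()
  ε-rules (there (here refl)) _ = 1∉external
  ε-rules (there (there (here refl))) _ = 1∉external
  ε-rules (there (there (there (here refl)))) _ = 1∉external
  ε-rules (there (there (there (there (here refl))))) _ = 1∉external

  total : ∀ {p} → p ∉ₛ external → ∀ X → ∃ λ q → ∃ λ Y → ∃ λ d → move p X q Y d ∈ δ
  total {zero}     p∉ _             = contradiction here p∉
  total {suc zero} _  ⊢             = _ , _ , _ , there (there (there (here refl)))
  total {suc zero} _  ⊣             = _ , _ , _ , there (there (here refl))
  -- Normalization demands a move here too, so on a letter the machine chooses between erasing and
  -- moving left.
  total {suc zero} _  (letter zero) = _ , _ , _ , there (there (there (there (here refl))))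

eraserGraph : Graph
eraserGraph = transitionGraph eraser eraser-normalized

-- Letters are added on the right, where the machine erases them.
tape : ℕ → List (TapeSymbol 1)
tape zero    = [ ⊢ ]
tape (suc n) = tape n ∷ʳ letter zero

length-tape : ∀ n → length (tape n) ≡ suc n
length-tape zero    = refl
length-tape (suc n) = trans (length-++ (tape n)) (trans (+-comm _ 1) (cong suc (length-tape n)))

tape-injective : Injective _≡_ _≡_ tape
tape-injective {m} {n} eq =
  suc-injective (trans (sym (length-tape m)) (trans (cong length eq) (length-tape n)))

tape-word : ∀ n → ∃ λ w → tape n ≡ ⊢ ∷ map letter w
tape-word zero    = [] , refl
tape-word (suc n) with w , eq ← tape-word n =
  w ∷ʳ zero , trans (cong (_∷ʳ letter zero) eq) (cong (⊢ ∷_) (sym (map-++ letter w [ zero ])))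

open LLBM eraser using (IsConfiguration; Step; moveʳ; moveˡ; erase; insert)

atEnd : ∀ n q → IsConfiguration (tape n ⟨ q ⟩ [ ⊣ ])
atEnd n q = (λ ()) , proj₁ (tape-word n) , cong (_++ [ ⊣ ]) (proj₂ (tape-word n))

beforeLast : ∀ n q → IsConfiguration (tape n ⟨ q ⟩ (letter zero ∷ ⊣ ∷ []))
beforeLast n q = (λ ()) , proj₁ (tape-word (suc n)) ,
  trans (sym (∷ʳ-++ (tape n) (letter zero) [ ⊣ ])) (proj₂ (proj₂ (atEnd (suc n) q)))

-- Erasing the last letter leaves the head on `⊣`; a step left then reaches the next letter. Once no
-- letter remains, that step reaches `⊢`, whose rule leads back to the external state.
erasing : ∀ n → Star (Step nothing) (tape n ⟨ suc zero ⟩ (letter zero ∷ ⊣ ∷ [])) ([ ⊢ ] ⟨ zero ⟩ [ ⊣ ])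
erasing n = (beforeLast n (suc zero) , atEnd n (suc zero) , erase (there (here refl))) ◅ rewind n
  where
  rewind : ∀ n → Star (Step nothing) (tape n ⟨ suc zero ⟩ [ ⊣ ]) ([ ⊢ ] ⟨ zero ⟩ [ ⊣ ])
  rewind zero =
    (atEnd 0 (suc zero) , start , moveˡ {u = []} (there (there (here refl)))) ◅
    (start , atEnd 0 zero , moveʳ {u = []} (there (there (there (here refl))))) ◅ ε
    where
    start : IsConfiguration ([] ⟨ suc zero ⟩ (⊢ ∷ ⊣ ∷ []))
    start = (λ ()) , [] , refl
  rewind (suc n) =
    (atEnd (suc n) (suc zero) , beforeLast n (suc zero) , moveˡ (there (there (here refl)))) ◅
    erasing n

-- The inserted letter is erased along with the `n` others, so the target is the same for all `n`.
eraserEdge : ∀ n → Edge eraserGraph (tape n ⟨ zero ⟩ [ ⊣ ]) 0 (tape 0 ⟨ zero ⟩ [ ⊣ ])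
eraserEdge n = zero , here , refl , (atEnd n zero , here) , (atEnd 0 zero , here) ,
  _ , (atEnd n zero , beforeLast n (suc zero) , insert (here refl)) , erasing n

eraser-notEmbeddable : ∀ H → FiniteDegree H → ¬ (eraserGraph ↪ H)
eraser-notEmbeddable H finiteDegree e =
  finite inNeighbour (proj₁ (uncurry finiteDegree (e.to (vertex 0)))) λ n →
    proj₂ (uncurry finiteDegree (e.to (vertex 0)))
      (e.preserves {vertex n} {0} {vertex 0} (eraserEdge n)) (inj₂ refl)
  where
  module e = _↪_ e

  vertex : ℕ → ∃ (Support eraserGraph)
  vertex n = tape n ⟨ zero ⟩ [ ⊣ ] , 0 , _ , inj₁ (eraserEdge n)

  -- Whole edges rather than sources are enumerated, to match the list in `FiniteDegree`; `finite`
  -- rules out an injection of `ℕ` into a list.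
  inNeighbour : ℕ ↣ (V H × Symbol × V H)
  inNeighbour = mk↣ {to = λ n → proj₁ (e.to (vertex n)) , 0 , proj₁ (e.to (vertex 0))} λ {m} {n} eq →
    tape-injective (cong Word.left (e.injective {vertex m} {vertex n} (cong proj₁ eq)))

proposition14 : (∃ λ (R : RationalPresentation) →
    FiniteDegree (rationalGraph R) ×
    (∀ (H : Graph) → LinearlyBounded H → ¬ (rationalGraph R ≅ H)))
    ×
    (∃ λ (G : Graph) →
    LinearlyBounded G ×
    (∀ (R : RationalPresentation) → FiniteDegree (rationalGraph R) →
    ¬ (G ≅ rationalGraph R)))
proposition14 =
  (doublingPresentation , doubling-finiteDegree , λ _ (M , N , H≅M) R≅H →
    doubling-notEmbeddable M N (↪-trans (≅⇒↪ R≅H) (≅⇒↪ H≅M))) ,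
  (eraserGraph , (eraser , eraser-normalized , ≅-refl) , λ R finiteDegree G≅R →
    eraser-notEmbeddable (rationalGraph R) finiteDegree (≅⇒↪ G≅R))
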